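{- For every integer $n \geq 2$ with $n \equiv 2 \pmod 4$, the $n$-dimensional balanced shuffle-cube $BSQ_n$ is vertex-bipancyclic, i.e. for every vertex $u$ of $BSQ_n$ and every even integer $l$ with $4 \leq l \leq |V(BSQ_n)| = 2^n$, there is a cycle of length $l$ in $BSQ_n$ that contains $u$.
   Context: All graphs are finite, simple and undirected. The length of a cycle is its number of edges. Notation for binary strings $u = u_{n-1}u_{n-2}\ldots u_1u_0$: the $4$-prefix is $p_4(u) = u_{n-1}u_{n-2}u_{n-3}u_{n-4}$ and the $(n-4)$-suffix is $s_{n-4}(u) = u_{n-5}\ldots u_1u_0$. The balanced shuffle-cube $BSQ_n$ is defined recursively for $n \equiv 2 \pmod 4$, $n \geq 2$; its vertices are all $2^n$ $n$-bit binary strings. $BSQ_2 = Q_2$ is the $4$-cycle on the strings $00,01,10,11$, two strings being adjacent iff they differ in exactly one bit. For $n > 2$, $BSQ_n$ is obtained from sixteen copies $BSQ_{n-4}^{i_1i_2i_3i_4}$ of $BSQ_{n-4}$, one for each $i_1,i_2,i_3,i_4 \in \{0,1\}$; the vertices of $BSQ_{n-4}^{i_1i_2i_3i_4}$ are the strings $u$ with $p_4(u) = i_1i_2i_3i_4$, and two vertices of the same copy are adjacent iff their $(n-4)$-suffixes are adjacent in $BSQ_{n-4}$. Two vertices $u,v$ in different copies are adjacent in $BSQ_n$ iff all of the following hold: (1) $s_{n-4}(u) = s_{n-4}(v)$; (2) $u_{n-2}$ and $v_{n-2}$ have different parities, and $v_{n-1}v_{n-2} = u_{n-1}u_{n-2}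 \pm 1$; (3) $v_{n-3}v_{n-4} = u_{n-3}u_{n-4} + (-1)^{u_{n-2}}$ or $v_{n-3}v_{n-4} = u_{n-3}u_{n-4}$. Here a pair of bits $ab$ is regarded as the integer $2a+b$, and addition and subtraction are modulo $4$. The graph $BSQ_n$ is bipartite. -}

module Defs where

open import Data.Digit using (Bit)
open import Data.Empty using (⊥)
open import Data.Fin using (Fin; toℕ)
open import Data.Fin.Properties using (all?; *↔×; 1↔⊤) renaming (_≟_ to _≟ᶠ_)
open import Data.Integer using (ℤ; +_; 1ℤ; -1ℤ; _+_; _-_; _^_)
open import Data.Integer.DivMod using (_%ℕ_)
open import Data.List using (List; _∷_; length; _∷ʳ_)
open import Data.List.Membership.Propositional using (_∈_)
open import Data.List.Relation.Unary.Linked using (Linked)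
open import Data.List.Relation.Unary.Unique.Propositional using (Unique)
open import Data.Nat as ℕ using (ℕ; suc; _≤_)
open import Data.Nat.Divisibility using (_∣_)
open import Data.Product using (∃₂; ∃!; _×_; _,_; uncurry)
open import Data.Product.Function.NonDependent.Propositional using (_×-↔_)
open import Data.Sum using (_⊎_; inj₁; inj₂)
open import Data.Unit using (tt)
open import Data.Vec using (Vec; []; _∷_; lookup; uncons)
open import Function using (_↔_; mk↔ₛ′)
open import Function.Properties.Inverse using (↔-refl; ↔-sym; ↔-trans)
open import Relation.Binary.Definitions using (Symmetric; Irreflexive)
open import Relation.Binary.PropositionalEquality
  using (_≡_; _≢_; refl; sym; ≢-sym)
open import Relation.Nullary.Decidable using (Dec; toWitness; _⊎-dec_; _→-dec_; ¬?)

record Graph : Set₁ where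
  field
    Vertex : Set
    _~_    : Vertex → Vertex → Set
    ~-sym  : Symmetric _~_
    ~-irr  : Irreflexive _≡_ _~_
    order  : ℕ
    finite : Vertex ↔ Fin order

module _ (G : Graph) where
  open Graph G

  -- The cycle through v ∷ vs in this order, closed by the edge from the
  -- last vertex back to v; it has as many edges as vertices.
  record IsCycle (v : Vertex) (vs : List Vertex) : Set where
    field
      long     : 3 ≤ length (v ∷ vs)
      distinct : Unique (v ∷ vs)
      closed   : Linked _~_ (v ∷ vs ∷ʳ v)

  VertexBipancyclic : Set
  VertexBipancyclic =
    ∀ (u : Vertex) (l : ℕ) → 2 ∣ l → 4 ≤ l → l ≤ order →
    ∃₂ λ v vs → IsCycle v vs × length (v ∷ vs) ≡ l × u ∈ v ∷ vs

-- The most significant bit comes first: u is u_{n-1} ∷ … ∷ u_0 ∷ [].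
BitString : ℕ → Set
BitString = Vec Bit

HypercubeAdj : ∀ {n} → BitString n → BitString n → Set
HypercubeAdj u v = ∃! _≡_ λ i → lookup u i ≢ lookup v i

-- Below, u₁ u₂ u₃ u₄ are the leading bits u_{n-1} u_{n-2} u_{n-3} u_{n-4}.
pair : Bit → Bit → ℤ
pair a b = + (2 ℕ.* toℕ a ℕ.+ toℕ b)

infix 4 _≡₄_
_≡₄_ : ℤ → ℤ → Set
i ≡₄ j = i %ℕ 4 ≡ j %ℕ 4

PlusMinusOne : (u₁ u₂ v₁ v₂ : Bit) → Set
PlusMinusOne u₁ u₂ v₁ v₂ =
  (pair v₁ v₂ ≡₄ pair u₁ u₂ + 1ℤ) ⊎ (pair v₁ v₂ ≡₄ pair u₁ u₂ - 1ℤ)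

ShiftOrEqual : (u₂ u₃ u₄ v₃ v₄ : Bit) → Set
ShiftOrEqual u₂ u₃ u₄ v₃ v₄ =
  (pair v₃ v₄ ≡₄ pair u₃ u₄ + -1ℤ ^ toℕ u₂) ⊎ (pair v₃ v₄ ≡₄ pair u₃ u₄)

-- Only the lengths n with n ≡ 2 (mod 4) are meaningful; the recursion for
-- the other residues starts from the edgeless graph.
BSQAdj : ∀ n → BitString n → BitString n → Set
BSQAdj 0 _ _ = ⊥
BSQAdj 1 _ _ = ⊥
BSQAdj 2 u v = HypercubeAdj u v
BSQAdj 3 _ _ = ⊥
BSQAdj (suc (suc (suc (suc n)))) (u₁ ∷ u₂ ∷ u₃ ∷ u₄ ∷ s) (v₁ ∷ v₂ ∷ v₃ ∷ v₄ ∷ t) =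
  (p ≡ q × BSQAdj n s t) ⊎
  (p ≢ q × s ≡ t × (u₂ ≢ v₂ × PlusMinusOne u₁ u₂ v₁ v₂) × ShiftOrEqual u₂ u₃ u₄ v₃ v₄)
  where
  p q : BitString 4
  p = u₁ ∷ u₂ ∷ u₃ ∷ u₄ ∷ []
  q = v₁ ∷ v₂ ∷ v₃ ∷ v₄ ∷ []

PlusMinusOne? : ∀ u₁ u₂ v₁ v₂ → Dec (PlusMinusOne u₁ u₂ v₁ v₂)
PlusMinusOne? _ _ _ _ = (_ ℕ.≟ _) ⊎-dec (_ ℕ.≟ _)

ShiftOrEqual? : ∀ u₂ u₃ u₄ v₃ v₄ → Dec (ShiftOrEqual u₂ u₃ u₄ v₃ v₄)
ShiftOrEqual? _ _ _ _ _ = (_ ℕ.≟ _) ⊎-dec (_ ℕ.≟ _)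

PlusMinusOne-sym : ∀ u₁ u₂ v₁ v₂ → PlusMinusOne u₁ u₂ v₁ v₂ → PlusMinusOne v₁ v₂ u₁ u₂
PlusMinusOne-sym = toWitness
  {a? = all? λ u₁ → all? λ u₂ → all? λ v₁ → all? λ v₂ →
        PlusMinusOne? u₁ u₂ v₁ v₂ →-dec PlusMinusOne? v₁ v₂ u₁ u₂} tt

ShiftOrEqual-sym : ∀ u₂ v₂ u₃ u₄ v₃ v₄ → u₂ ≢ v₂ →
                   ShiftOrEqual u₂ u₃ u₄ v₃ v₄ → ShiftOrEqual v₂ v₃ v₄ u₃ u₄
ShiftOrEqual-sym = toWitness
  {a? = all? λ u₂ → all? λ v₂ → all? λ u₃ → all? λ u₄ → all? λ v₃ → all? λ v₄ →
        ¬? (u₂ ≟ᶠ v₂) →-dec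
        (ShiftOrEqual? u₂ u₃ u₄ v₃ v₄ →-dec ShiftOrEqual? v₂ v₃ v₄ u₃ u₄)} tt

BSQAdj-sym : ∀ n → Symmetric (BSQAdj n)
BSQAdj-sym 2 (i , d , unique) = i , ≢-sym d , λ e → unique (≢-sym e)
BSQAdj-sym (suc (suc (suc (suc n)))) {_ ∷ _ ∷ _ ∷ _ ∷ _} {_ ∷ _ ∷ _ ∷ _ ∷ _}
  (inj₁ (p≡q , st)) = inj₁ (sym p≡q , BSQAdj-sym n st)
BSQAdj-sym (suc (suc (suc (suc n)))) {u₁ ∷ u₂ ∷ u₃ ∷ u₄ ∷ _} {v₁ ∷ v₂ ∷ v₃ ∷ v₄ ∷ _}
  (inj₂ (p≢q , s≡t , (u₂≢v₂ , pm) , sh)) =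
  inj₂ ( ≢-sym p≢q , sym s≡t
       , (≢-sym u₂≢v₂ , PlusMinusOne-sym u₁ u₂ v₁ v₂ pm)
       , ShiftOrEqual-sym u₂ v₂ u₃ u₄ v₃ v₄ u₂≢v₂ sh)

BSQAdj-irr : ∀ n → Irreflexive _≡_ (BSQAdj n)
BSQAdj-irr 2 refl (_ , d , _) = d refl
BSQAdj-irr (suc (suc (suc (suc n)))) {_ ∷ _ ∷ _ ∷ _ ∷ _} refl (inj₁ (_ , ss)) =
  BSQAdj-irr n refl ss
BSQAdj-irr (suc (suc (suc (suc n)))) {_ ∷ _ ∷ _ ∷ _ ∷ _} refl (inj₂ (p≢p , _)) =
  p≢p refl

BitString↔Fin : ∀ n → BitString n ↔ Fin (2 ℕ.^ n)
BitString↔Fin ℕ.zero = ↔-trans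
  (mk↔ₛ′ (λ _ → tt) (λ _ → []) (λ _ → refl) (λ { [] → refl }))
  (↔-sym 1↔⊤)
BitString↔Fin (suc n) = ↔-trans
  (mk↔ₛ′ uncons (uncurry _∷_) (λ { (_ , _) → refl }) (λ { (_ ∷ _) → refl }))
  (↔-trans (↔-refl ×-↔ BitString↔Fin n) (↔-sym *↔×))

BSQ : ℕ → Graph
BSQ n = record
  { Vertex = BitString n
  ; _~_    = BSQAdj n
  ; ~-sym  = BSQAdj-sym n
  ; ~-irr  = BSQAdj-irr n
  ; order  = 2 ℕ.^ n
  ; finite = BitString↔Fin n
  }

{-# OPTIONS --safe #-}
-- BSQ_{4+n} is the Cartesian product of BSQ_n with a Hamiltonian graph on the
-- sixteen 4-bit prefixes, and the last bit is a K₂-factor of BSQ_n.  Sweeping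
-- along a Hamiltonian path of the remaining factors gives a path through all
-- strings without their last bit, starting anywhere; its product with K₂ is a
-- spanning ladder of BSQ_n.  The first q rungs of a ladder bound a cycle of
-- length 2q through its corner.
module Submission where

open import Defs
open import Data.Digit using (Bit)
open import Data.Empty using (⊥-elim)
open import Data.Fin using (opposite)
open import Data.Fin.Patterns using (0F; 1F)
open import Data.Fin.Properties using (all?) renaming (_≟_ to _≟ᶠ_)
open import Data.List using (List; []; _∷_; [_]; length; map; take; reverse; iterate; _++_; _ʳ++_; _∷ʳ_)
open import Data.List.Membership.Propositional.Properties using (∈-map⁻)
open import Data.List.Properties
  using (length-++; length-map; length-reverse; length-iterate; length-take; ++-assoc; ʳ++-defn)
open import Data.List.Relation.Binary.Disjoint.Propositional using (Disjoint)
open import Data.List.Relation.Binary.Permutation.Setoid.Properties using (Unique-resp-↭; ↭-reverse)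
open import Data.List.Relation.Binary.Permutation.Setoid using (↭-sym)
open import Data.List.Relation.Unary.All as All using (All; []; _∷_)
import Data.List.Relation.Unary.All.Properties as All
open import Data.List.Relation.Unary.AllPairs using ([]; _∷_)
open import Data.List.Relation.Unary.Any using (here)
import Data.List.Relation.Unary.Any.Properties as Any
open import Data.List.Relation.Unary.Linked using (Linked; []; [-]; _∷_)
open import Data.List.Relation.Unary.Unique.Propositional using (Unique)
import Data.List.Relation.Unary.Unique.Propositional.Properties as Unique
import Data.List.Relation.Unary.Unique.DecPropositional as DecUnique
open import Data.Nat using (ℕ; zero; suc; _≤_; z≤n; s≤s; _+_; _*_; _^_; _%_)
open import Data.Nat.Divisibility using (divides)
open import Data.Nat.GeneralisedArithmetic using () renaming (iterate to iterateℕ)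
open import Data.Nat.Properties
  using (*-comm; *-assoc; ^-distribˡ-+-*; +-identityʳ; *-cancelˡ-≤; *-cancelʳ-≤; m≤n⇒m⊓n≡m; module ≤-Reasoning)
open import Data.Product using (∃; ∃₂; _×_; _,_; proj₁; proj₂)
open import Data.Sum using (inj₁; inj₂)
open import Data.Unit using (tt)
open import Data.Vec as Vec using ([]; _∷_)
open import Data.Vec.Properties using (≡-dec; ++-injective)
open import Function using (_∘_)
open import Level using (0ℓ)
open import Relation.Binary.Core using (Rel)
open import Relation.Binary.PropositionalEquality
  using (_≡_; _≢_; refl; sym; trans; cong; cong₂; subst; setoid; module ≡-Reasoning)
open import Relation.Nullary.Decidable using (Dec; toWitness; map′; ¬?; _×-dec_)

-- Paths with a prescribed start

record PathFrom {A : Set} (_~_ : Rel A 0ℓ) (m : ℕ) (x : A) : Set where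
  field
    rest   : List A
    linked : Linked _~_ (x ∷ rest)
    unique : Unique (x ∷ rest)
    size   : length (x ∷ rest) ≡ m

take-linked : ∀ {A : Set} {_~_ : Rel A 0ℓ} m {xs} → Linked _~_ xs → Linked _~_ (take m xs)
take-linked zero          _        = []
take-linked (suc m)       []       = []
take-linked (suc zero)    [-]      = [-]
take-linked (suc (suc m)) [-]      = [-]
take-linked (suc zero)    (_ ∷ _)  = [-]
take-linked (suc (suc m)) (r ∷ rs) = r ∷ take-linked (suc m) rs

shorten : ∀ {A : Set} {_~_ : Rel A 0ℓ} {m x} l → suc l ≤ m →
          PathFrom _~_ m x → PathFrom _~_ (suc l) x
shorten {x = x} l (s≤s l≤m) record { rest = rest ; linked = linked ; unique = unique ; size = refl } = record
  { rest   = take l rest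
  ; linked = take-linked (suc l) linked
  ; unique = Unique.take⁺ (suc l) unique
  ; size   = cong suc (trans (length-take l rest) (m≤n⇒m⊓n≡m l≤m))
  }

-- Sweeping a product row by row

module Snake
  {A B : Set} (_~ᴮ_ : Rel B 0ℓ) (_~_ : Rel (A × B) 0ℓ)
  (next : A → A) (m : ℕ)
  (advance : ∀ a y → (a , y) ~ (next a , y))
  (switch : ∀ a {y z} → y ~ᴮ z → (a , y) ~ (a , z))
  (orbit-unique : ∀ a → Unique (iterate next a (suc m)))
  where

  row : A → B → ℕ → List (A × B)
  row a y l = map (_, y) (iterate next a l)

  -- Every row is traversed forwards, but starts where the previous one ends.
  snake : A → List B → List (A × B)
  snake a []       = []
  snake a (y ∷ ys) = row a y (suc m) ++ snake (iterateℕ next a m) ys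

  -- Stated with a continuation: the hypothesis starts at the last entry of the row, so the row and
  -- whatever follows it are joined in one induction.
  row-linked : ∀ l a y {zs} → Linked _~_ ((iterateℕ next a l , y) ∷ zs) →
               Linked _~_ (row a y (suc l) ++ zs)
  row-linked zero    a y rs = rs
  row-linked (suc l) a y rs = advance a y ∷ row-linked l (next a) y rs

  snake-linked : ∀ a {ys} → Linked _~ᴮ_ ys → Linked _~_ (snake a ys)
  snake-linked a []       = []
  snake-linked a [-]      = row-linked m a _ [-]
  snake-linked a (r ∷ rs) = row-linked m a _ (switch _ r ∷ snake-linked _ rs)

  snake-avoids : ∀ a {y zs} → All (y ≢_) zs → All ((y ≢_) ∘ proj₂) (snake a zs)
  snake-avoids a []        = []
  snake-avoids a (y≢z ∷ ps) = All.++⁺ (All.map⁺ (All.universal (λ _ → y≢z) _)) (snake-avoids _ ps)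

  -- Entries of one row differ in the first component, entries of different rows in the second.
  snake-unique : ∀ a {ys} → Unique ys → Unique (snake a ys)
  snake-unique a []                   = []
  snake-unique a {y ∷ ys} (y∉ys ∷ ps) =
    Unique.++⁺ (Unique.map⁺ (cong proj₁) (orbit-unique a)) (snake-unique _ ps) disjoint
    where
    disjoint : Disjoint (row a y (suc m)) (snake (iterateℕ next a m) ys)
    disjoint (p , q) with ∈-map⁻ _ p
    ... | _ , _ , refl = All.lookup (snake-avoids _ y∉ys) q refl

  snake-length : ∀ a ys → length (snake a ys) ≡ length ys * suc m
  snake-length a []       = refl
  snake-length a (y ∷ ys) = trans (length-++ (row a y (suc m)))
    (cong₂ _+_ (trans (length-map _ (iterate next a (suc m))) (length-iterate next a (suc m)))
               (snake-length _ ys))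

  snake-path : ∀ {l a y} → PathFrom _~ᴮ_ l y → PathFrom _~_ (l * suc m) (a , y)
  snake-path {a = a} {y} record { rest = ys ; linked = linked ; unique = unique ; size = refl } = record
    { rest   = _
    ; linked = snake-linked a linked
    ; unique = snake-unique a unique
    ; size   = snake-length a (y ∷ ys)
    }

-- Boundary cycle of a ladder

module _ (G : Graph) where
  open Graph G

  module Ladder
    {A : Set} (_~ᴬ_ : Rel A 0ℓ) (left right : A → Vertex)
    (left-along  : ∀ {x y} → x ~ᴬ y → left x ~ left y)
    (right-along : ∀ {x y} → x ~ᴬ y → right x ~ right y)
    (rung : ∀ x → left x ~ right x)
    (left-injective  : ∀ {x y} → left x ≡ left y → x ≡ y)
    (right-injective : ∀ {x y} → right x ≡ right y → x ≡ y)
    (left≢right : ∀ {x y} → left x ≢ right y)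
    where

    -- `zs` accumulates the way back: each edge taken on the left rail prepends the reversed right
    -- edge to it, and the last rung joins the two sides.
    boundary-linked : ∀ {x xs zs} → Linked _~ᴬ_ (x ∷ xs) → Linked _~_ (right x ∷ zs) →
                      Linked _~_ (map left (x ∷ xs) ++ map right (x ∷ xs) ʳ++ zs)
    boundary-linked {x} [-]      zs = rung x ∷ zs
    boundary-linked     (r ∷ rs) zs = left-along r ∷ boundary-linked rs (~-sym (right-along r) ∷ zs)

    boundary : ∀ {l x} → PathFrom _~ᴬ_ (2 + l) x →
               ∃ λ vs → IsCycle G (left x) vs × length (left x ∷ vs) ≡ (2 + l) * 2
    boundary {l} {x} record { rest = xs@(_ ∷ _) ; linked = linked ; unique = unique ; size = size } =
      vs , record { long = long ; distinct = distinct ; closed = closed } , total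
      where
      open ≡-Reasoning

      vs : List Vertex
      vs = map left xs ++ reverse (map right (x ∷ xs))

      total : length (left x ∷ vs) ≡ (2 + l) * 2
      total = begin
        length (map left (x ∷ xs) ++ reverse (map right (x ∷ xs)))
          ≡⟨ length-++ (map left (x ∷ xs)) ⟩
        length (map left (x ∷ xs)) + length (reverse (map right (x ∷ xs)))
          ≡⟨ cong₂ _+_ (trans (length-map left (x ∷ xs)) size)
               (trans (length-reverse (map right (x ∷ xs))) (trans (length-map right (x ∷ xs)) size)) ⟩
        (2 + l) + (2 + l)
          ≡⟨ cong ((2 + l) +_) (sym (+-identityʳ (2 + l))) ⟩
        2 * (2 + l)
          ≡⟨ *-comm 2 (2 + l) ⟩
        (2 + l) * 2 ∎

      long : 3 ≤ length (left x ∷ vs)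
      long = subst (3 ≤_) (sym total) (s≤s (s≤s (s≤s z≤n)))

      disjoint : Disjoint (map left (x ∷ xs)) (reverse (map right (x ∷ xs)))
      disjoint (p , q) with ∈-map⁻ left p | ∈-map⁻ right (Any.reverse⁻ {xs = map right (x ∷ xs)} q)
      ... | _ , _ , refl | _ , _ , eq = left≢right eq

      distinct : Unique (left x ∷ vs)
      distinct = Unique.++⁺
        (Unique.map⁺ left-injective unique)
        (Unique-resp-↭ (setoid _) (↭-sym (setoid _) (↭-reverse (setoid _) _)) (Unique.map⁺ right-injective unique))
        disjoint

      closed : Linked _~_ (left x ∷ vs ∷ʳ left x)
      closed = subst (Linked _~_)
        (trans (cong (map left (x ∷ xs) ++_) (ʳ++-defn (map right (x ∷ xs))))
               (sym (++-assoc (map left (x ∷ xs)) _ _)))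
        -- The way back is seeded with the first rung reversed, which closes the cycle at `left x`.
        (boundary-linked linked (~-sym (rung x) ∷ [-]))

-- A Hamiltonian cycle on the prefixes

∀-bits? : ∀ {n} {P : BitString n → Set} → (∀ u → Dec (P u)) → Dec (∀ u → P u)
∀-bits? {zero}  P? = map′ (λ { p [] → p }) (λ f → f []) (P? [])
∀-bits? {suc n} P? =
  map′ (λ { f (b ∷ u) → f b u }) (λ g b u → g (b ∷ u)) (all? λ b → ∀-bits? (P? ∘ (b ∷_)))

-- The part of adjacency between different copies that concerns prefixes. It does not involve the
-- common suffix, whence the product structure.
CrossAdj : Rel (BitString 4) 0ℓ
CrossAdj p@(u₁ ∷ u₂ ∷ u₃ ∷ u₄ ∷ []) q@(v₁ ∷ v₂ ∷ v₃ ∷ v₄ ∷ []) =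
  p ≢ q × (u₂ ≢ v₂ × PlusMinusOne u₁ u₂ v₁ v₂) × ShiftOrEqual u₂ u₃ u₄ v₃ v₄

CrossAdj? : ∀ p q → Dec (CrossAdj p q)
CrossAdj? p@(u₁ ∷ u₂ ∷ u₃ ∷ u₄ ∷ []) q@(v₁ ∷ v₂ ∷ v₃ ∷ v₄ ∷ []) =
  ¬? (≡-dec _≟ᶠ_ p q) ×-dec
  (¬? (u₂ ≟ᶠ v₂) ×-dec PlusMinusOne? u₁ u₂ v₁ v₂) ×-dec ShiftOrEqual? u₂ u₃ u₄ v₃ v₄

-- As a pair of residues modulo 4, (a , b) ↦ (a + 1 , b), except that
-- (3 , b) ↦ (0 , b - 1).
next : BitString 4 → BitString 4
next (a  ∷ 0F ∷ w)           = a ∷ 1F ∷ w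
next (0F ∷ 1F ∷ w)           = 1F ∷ 0F ∷ w
next (1F ∷ 1F ∷ b ∷ 0F ∷ []) = 0F ∷ 0F ∷ opposite b ∷ 1F ∷ []
next (1F ∷ 1F ∷ b ∷ 1F ∷ []) = 0F ∷ 0F ∷ b ∷ 0F ∷ []

-- Where the first residue is 3, `u₂` is 1, so the shift allowed for the second residue is exactly
-- -1. Evaluation checks all sixteen cases.
next-adj : ∀ p → CrossAdj p (next p)
next-adj = toWitness {a? = ∀-bits? λ p → CrossAdj? p (next p)} tt

-- The second residue drops once in every four steps, so no pair recurs before step sixteen. With
-- only sixteen prefixes, each such orbit is a Hamiltonian path.
next-orbit-unique : ∀ p → Unique (iterate next p 16)
next-orbit-unique = toWitness {a? = ∀-bits? λ p → DecUnique.unique? (≡-dec _≟ᶠ_) (iterate next p 16)} tt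

-- Stems, rails and rungs

dim : ℕ → ℕ
dim zero    = 2
dim (suc k) = 4 + dim k

≡2mod4⇒dim : ∀ n → n % 4 ≡ 2 → ∃ λ k → n ≡ dim k
≡2mod4⇒dim 0 ()
≡2mod4⇒dim 1 ()
≡2mod4⇒dim 2 _ = 0 , refl
≡2mod4⇒dim 3 ()
-- `(4 + n) % 4` computes to `n % 4`, so `eq` serves the recursive call as it is.
≡2mod4⇒dim (suc (suc (suc (suc n)))) eq with ≡2mod4⇒dim n eq
... | k , refl = suc k , refl

-- The strings of length dim k without their last bit.
Stem : ℕ → Set
Stem zero    = Bit
Stem (suc k) = BitString 4 × Stem k

rail : ∀ k → Bit → Stem k → BitString (dim k)
rail zero    b a       = a ∷ b ∷ []
rail (suc k) b (p , x) = p Vec.++ rail k b x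

-- Quantifying over `b` puts the edge on both rails at once, so a path of stems yields two parallel
-- sides.
StemAdj : ∀ k → Rel (Stem k) 0ℓ
StemAdj k x y = ∀ b → BSQAdj (dim k) (rail k b x) (rail k b y)

inside : ∀ {n} p {s t} → BSQAdj n s t → BSQAdj (4 + n) (p Vec.++ s) (p Vec.++ t)
inside (_ ∷ _ ∷ _ ∷ _ ∷ []) r = inj₁ (refl , r)

across : ∀ {n} p q (s : BitString n) → CrossAdj p q → BSQAdj (4 + n) (p Vec.++ s) (q Vec.++ s)
across (_ ∷ _ ∷ _ ∷ _ ∷ []) (_ ∷ _ ∷ _ ∷ _ ∷ []) s (p≢q , c) = inj₂ (p≢q , refl , c)

-- Equality of stems makes each rail injective; equality of bits keeps the two rails disjoint.
rail-injective : ∀ k {b c x y} → rail k b x ≡ rail k c y → b ≡ c × x ≡ y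
rail-injective zero    refl = refl , refl
rail-injective (suc k) {x = p , x} {y = q , y} eq with ++-injective p q eq
... | refl , eq′ with rail-injective k eq′
... | refl , refl = refl , refl

-- Lets an arbitrary vertex be the corner of a ladder.
rail-surjective : ∀ k u → ∃₂ λ b x → rail k b x ≡ u
rail-surjective zero    (a ∷ b ∷ []) = b , a , refl
rail-surjective (suc k) (u₁ ∷ u₂ ∷ u₃ ∷ u₄ ∷ s) with rail-surjective k s
... | b , x , refl = b , (u₁ ∷ u₂ ∷ u₃ ∷ u₄ ∷ [] , x) , refl

rail-rung : ∀ k {b c} → b ≢ c → ∀ x → BSQAdj (dim k) (rail k b x) (rail k c x)
-- The witness `1F` is the position of the last bit; position `0F` carries `a` on both sides.
rail-rung zero    b≢c a = 1F , b≢c , λ { {0F} a≢a → ⊥-elim (a≢a refl) ; {1F} _ → refl }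
rail-rung (suc k) b≢c (p , x) = inside p (rail-rung k b≢c x)

opposite-≢ : ∀ (b : Bit) → b ≢ opposite b
opposite-≢ 0F ()
opposite-≢ 1F ()

stem-size : ℕ → ℕ
stem-size zero    = 2
stem-size (suc k) = stem-size k * 16

-- Shows that a ladder on `stem-size k` rungs is spanning.
stem-size-double : ∀ k → 2 * stem-size k ≡ 2 ^ dim k
stem-size-double zero    = refl
stem-size-double (suc k) = begin
  2 * (stem-size k * 16)   ≡⟨ *-assoc 2 (stem-size k) 16 ⟨
  2 * stem-size k * 16     ≡⟨ cong (_* 16) (stem-size-double k) ⟩
  2 ^ dim k * 16           ≡⟨ *-comm (2 ^ dim k) 16 ⟩
  16 * 2 ^ dim k           ≡⟨ ^-distribˡ-+-* 2 4 (dim k) ⟨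
  2 ^ dim (suc k)          ∎
  where open ≡-Reasoning

-- The start is arbitrary so that the ladder can begin at the rung of any vertex.
stem-path : ∀ k x → PathFrom (StemAdj k) (stem-size k) x
stem-path zero a = record
  { rest   = [ opposite a ]
  ; linked = (λ b → 0F , opposite-≢ a , λ { {0F} _ → refl ; {1F} b≢b → ⊥-elim (b≢b refl) }) ∷ [-]
  ; unique = (opposite-≢ a ∷ []) ∷ [] ∷ []
  ; size   = refl
  }
-- Each entry of the path of shorter stems becomes a row through all sixteen prefixes, hence 15
-- steps of `next`.
stem-path (suc k) (p , x) = Snake.snake-path (StemAdj k) (StemAdj (suc k)) next 15
  (λ q y b → across q (next q) (rail k b y) (next-adj q))
  (λ q r b → inside q (r b))
  next-orbit-unique (stem-path k x)

-- Cycles through a given vertex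

BSQ-vertex-bipancyclic : ∀ k → VertexBipancyclic (BSQ (dim k))
BSQ-vertex-bipancyclic k u .(q * 2) (divides q refl) 4≤l l≤order
  -- Cancelling 2 in `4 ≤ q * 2` gives `2 ≤ q`, so `q` is `2 + j`: at least two rungs, as `boundary`
  -- requires.
  with rail-surjective k u | *-cancelʳ-≤ 2 q 2 4≤l
... | b , x , refl | s≤s (s≤s {n = j} _) =
  _ , proj₁ cycle , proj₁ (proj₂ cycle) , proj₂ (proj₂ cycle) , here refl
  where
  q≤size : q ≤ stem-size k
  q≤size = *-cancelˡ-≤ 2 (begin
    2 * q              ≡⟨ *-comm 2 q ⟩
    q * 2              ≤⟨ l≤order ⟩
    2 ^ dim k          ≡⟨ stem-size-double k ⟨
    2 * stem-size k    ∎)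
    where open ≤-Reasoning

  -- The left rail carries the last bit of `u`, so the corner `left x` is `u` itself.
  open Ladder (BSQ (dim k)) (StemAdj k) (rail k b) (rail k (opposite b))
    (λ r → r b) (λ r → r (opposite b)) (rail-rung k (opposite-≢ b))
    (proj₂ ∘ rail-injective k) (proj₂ ∘ rail-injective k)
    (opposite-≢ b ∘ proj₁ ∘ rail-injective k)

  cycle = boundary (shorten (suc j) q≤size (stem-path k x))

theorem10 : ∀ (n : ℕ) → 2 ≤ n → n % 4 ≡ 2 → VertexBipancyclic (BSQ n)
theorem10 n _ n%4≡2 with ≡2mod4⇒dim n n%4≡2
... | k , refl = BSQ-vertex-bipancyclic k
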